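{- For every $n\geq 1$ there exists a bijection $$\alpha:\mathfrak{S}_n(31245,32145,31254,32154)\rightarrow\mathfrak{S}_n(31425,32415,31524,32514)$$ such that for every $\pi\in\mathfrak{S}_n(31245,32145,31254,32154)$, $$(\mathrm{Ides},\mathrm{Lrmax},\mathrm{Lrmin},\mathrm{Rlmax},\mathrm{Iar})(\alpha(\pi))=(\mathrm{Ides},\mathrm{Lrmax},\mathrm{Lrmin},\mathrm{Rlmax},\mathrm{Iar})(\pi).$$
   Context: $\mathfrak{S}_n$ is the set of permutations of $[n]=\{1,\dots,n\}$, written as words $\pi=\pi_1\cdots\pi_n$. A word $W=w_1\cdots w_n$ contains a pattern $P=p_1\cdots p_k$ if there are indices $i_1<\dots<i_k$ with $w_{i_1}\cdots w_{i_k}$ order-isomorphic to $P$; otherwise $W$ avoids $P$. $\mathfrak{S}_n(P_1,\dots,P_r)$ is the set of permutations in $\mathfrak{S}_n$ avoiding each of $P_1,\dots,P_r$. For $\pi\in\mathfrak{S}_n$: $\mathrm{Ides}(\pi)=\{i\in[n-1]:\pi^{ -1}(i)>\pi^{ -1}(i+1)\}$; $\mathrm{Lrmax}(\pi)$ (resp. $\mathrm{Lrmin}(\pi)$) is the set of values $\pi_i$ with $\pi_i>\pi_j$ (resp. $\pi_i<\pi_j$) for all $j<i$; $\mathrm{Rlmax}(\pi)$ is the set of values $\pi_i$ with $\pi_i>\pi_j$ for all $j>i$; $\mathrm{Iar}(\pi)$ is the set of entries of the initial ascending run of $\pi$, i.e. $\{\pi_1,\dots,\pi_m\}$ where $m$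 is maximal with $\pi_1<\pi_2<\dots<\pi_m$. -}

module Defs where

open import Data.Nat using (ℕ; suc; _≤_; _∸_) renaming (_<_ to _<ℕ_)
open import Data.Fin using (Fin; toℕ; _<_)
open import Data.Vec using (Vec; lookup; _∷_; [])
open import Data.Product using (Σ; ∃; _×_; _,_)
open import Relation.Binary.PropositionalEquality using (_≡_)
open import Relation.Nullary using (¬_)
open import Function.Bundles using (_⇔_)

-- A permutation of [n] in one-line notation: a word of length n over Fin n
-- (value v : Fin n stands for the number toℕ v + 1) with distinct letters.
Word : ℕ → Set
Word n = Vec (Fin n) n

IsPerm : ∀ {n} → Word n → Set
IsPerm {n} w = ∀ (i j : Fin n) → lookup w i ≡ lookup w j → i ≡ j

val : ∀ {n} → Word n → Fin n → ℕ
val w i = suc (toℕ (lookup w i))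

Contains : ∀ {n k} → Word n → Vec ℕ k → Set
Contains {n} {k} w p =
  Σ (Fin k → Fin n) λ f →
    (∀ a b → a < b → f a < f b) ×
    (∀ a b → (lookup w (f a) < lookup w (f b)) ⇔ (lookup p a <ℕ lookup p b))

Avoids : ∀ {n k} → Word n → Vec ℕ k → Set
Avoids w p = ¬ Contains w p

InClassA : ∀ {n} → Word n → Set
InClassA w = IsPerm w
  × Avoids w (3 ∷ 1 ∷ 2 ∷ 4 ∷ 5 ∷ [])
  × Avoids w (3 ∷ 2 ∷ 1 ∷ 4 ∷ 5 ∷ [])
  × Avoids w (3 ∷ 1 ∷ 2 ∷ 5 ∷ 4 ∷ [])
  × Avoids w (3 ∷ 2 ∷ 1 ∷ 5 ∷ 4 ∷ [])

InClassB : ∀ {n} → Word n → Set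
InClassB w = IsPerm w
  × Avoids w (3 ∷ 1 ∷ 4 ∷ 2 ∷ 5 ∷ [])
  × Avoids w (3 ∷ 2 ∷ 4 ∷ 1 ∷ 5 ∷ [])
  × Avoids w (3 ∷ 1 ∷ 5 ∷ 2 ∷ 4 ∷ [])
  × Avoids w (3 ∷ 2 ∷ 5 ∷ 1 ∷ 4 ∷ [])

-- Set-valued statistics, as predicates on values k ∈ ℕ (1-indexed as in the paper).

Ides : ∀ {n} → Word n → ℕ → Set
Ides {n} w k = (1 ≤ k) × (k ≤ n ∸ 1) ×
  Σ (Fin n) λ i → Σ (Fin n) λ j → (val w i ≡ k) × (val w j ≡ suc k) × (j < i)

Lrmax : ∀ {n} → Word n → ℕ → Set
Lrmax {n} w v = Σ (Fin n) λ i → (val w i ≡ v) ×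
  (∀ j → j < i → lookup w j < lookup w i)

Lrmin : ∀ {n} → Word n → ℕ → Set
Lrmin {n} w v = Σ (Fin n) λ i → (val w i ≡ v) ×
  (∀ j → j < i → lookup w i < lookup w j)

Rlmax : ∀ {n} → Word n → ℕ → Set
Rlmax {n} w v = Σ (Fin n) λ i → (val w i ≡ v) ×
  (∀ j → i < j → lookup w j < lookup w i)

Iar : ∀ {n} → Word n → ℕ → Set
Iar {n} w v = Σ (Fin n) λ i → (val w i ≡ v) ×
  (∀ j k → toℕ k ≡ suc (toℕ j) → toℕ k ≤ toℕ i → lookup w j < lookup w k)

SameSet : (ℕ → Set) → (ℕ → Set) → Set
SameSet S T = ∀ v → S v ⇔ T v

SameStats : ∀ {n} → Word n → Word n → Set
SameStats σ π =
  SameSet (Ides σ) (Ides π) × SameSet (Lrmax σ) (Lrmax π) ×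
  SameSet (Lrmin σ) (Lrmin π) × SameSet (Rlmax σ) (Rlmax π) ×
  SameSet (Iar σ) (Iar π)

{-# OPTIONS --safe #-}
module Submission where

-- Call a letter s small and l large for c when s < c < l.  The first class forbids subwords c s s l l, the
-- second c s l s l, so both are described by exchanging adjacent letters s l and l s that lie on different
-- sides of an earlier letter g which has already been followed by a smaller letter, when a letter larger than
-- g comes later.  Allowing every such g is not confluent (start from 3152467); g is therefore required to be
-- active: reading a letter x activates the earlier letters c > x that have no active letter strictly between
-- x and c.  Exchanging two letters on different sides of an active letter does not affect which letters become
-- active later, so the exchanges s l → l s and the reverse exchanges l s → s l are both locally confluent,
-- hence confluent by Newman's lemma.  The normal forms of the former are the first class and those of the
-- latter the second, so α takes normal forms of the latter.  Each exchange preserves the five statistics.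

open import Defs
open import Data.Nat using (ℕ; _≤_; zero; suc; _+_; z≤n; s≤s; s<s⁻¹) renaming (_<_ to _<ℕ_)
open import Data.Nat.Properties using (+-monoʳ-<; +-comm; +-assoc; ≤-reflexive; ≤-trans; ≤-pred; <⇒≤; <⇒≢; <⇒≱; m<n⇒0<n; m<n⇒m<1+n; n≤1+n; m≤n⇒m<n∨m≡n; suc-injective) renaming (<-trans to <ℕ-trans; _<?_ to _<ℕ?_)
open import Data.Nat.Induction using (<-wellFounded)
open import Data.Fin using (Fin; zero; suc; toℕ; fromℕ<; _<_)
open import Data.Fin.Properties using (_≟_; _<?_; <-trans; <-irrefl; <-asym; <-cmp; all?; any?; toℕ<n; toℕ-fromℕ<; toℕ-injective)
open import Data.Vec using (Vec; []; _∷_; lookup; map; tabulate)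
open import Data.Vec.Properties using (lookup∘tabulate; lookup-map)
open import Data.Vec.Relation.Unary.Linked using (Linked; [-]; _∷_)
open import Data.Vec.Relation.Unary.Linked.Properties using (lookup⁺)
open import Data.List using (List; []; _∷_; _++_)
open import Data.List.Membership.Propositional using (_∈_)
open import Data.List.Membership.Propositional.Properties using (∈-insert)
open import Data.List.Relation.Unary.Any using (here; there) renaming (any? to anyL?)
open import Data.Product using (Σ; ∃; ∃₂; _×_; _,_; proj₁; proj₂)
open import Data.Sum using (_⊎_; inj₁; inj₂; [_,_]′; map₁)
open import Data.Empty using (⊥; ⊥-elim)
open import Function using (_∘_; flip)
open import Function.Bundles using (mk⇔; Equivalence)
open import Induction.WellFounded using (Acc; acc)
import Induction.WellFounded as WF
import Relation.Binary.Construct.On as On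
open import Relation.Binary.Construct.Closure.ReflexiveTransitive using (Star; ε; _◅_; gmap; reverse)
open import Relation.Binary.Construct.Closure.Transitive using (Plus; [_]; _∼⁺⟨_⟩_)
open import Relation.Binary.Definitions using (tri<; tri≈; tri>)
open import Relation.Binary.PropositionalEquality using (_≡_; refl; sym; trans; cong; subst; subst₂)
open import Relation.Binary.Rewriting using (IsNormalForm; HasNormalForm; Confluent; StronglyNormalizing; sn&wcr⇒cr)
open import Relation.Nullary using (¬_; Dec; yes; no; contradiction)
open import Relation.Nullary.Decidable using (_×-dec_; _⊎-dec_; ¬?; True; toWitness)

private variable
  n m k k′ : ℕ

-- Subwords.

infix 4 _⊆_

data _⊆_ {n} : Vec (Fin n) k → Vec (Fin n) m → Set where
  []   : [] ⊆ []
  keep : ∀ {x} {u : Vec (Fin n) k} {v : Vec (Fin n) m} → u ⊆ v → x ∷ u ⊆ x ∷ v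
  skip : ∀ {x} {u : Vec (Fin n) k} {v : Vec (Fin n) m} → u ⊆ v → u ⊆ x ∷ v

[]⊆ : (v : Vec (Fin n) m) → [] ⊆ v
[]⊆ []      = []
[]⊆ (_ ∷ v) = skip ([]⊆ v)

⊆-trans : {u : Vec (Fin n) k} {v : Vec (Fin n) k′} {w : Vec (Fin n) m} → u ⊆ v → v ⊆ w → u ⊆ w
⊆-trans p        []       = p
⊆-trans p        (skip q) = skip (⊆-trans p q)
⊆-trans (keep p) (keep q) = keep (⊆-trans p q)
⊆-trans (skip p) (keep q) = skip (⊆-trans p q)

occurs? : (x : Fin n) (v : Vec (Fin n) m) → Dec (x ∷ [] ⊆ v)
occurs? x []      = no λ ()
occurs? x (y ∷ v) with x ≟ y | occurs? x v
... | yes refl | _     = yes (keep ([]⊆ v))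
... | no _     | yes p = yes (skip p)
... | no x≢y   | no ¬p = no λ { (keep _) → x≢y refl ; (skip p) → ¬p p }

-- Active letters of a prefix.

-- The argument list is the part of the word read so far, most recent letter first.
Active : List (Fin n) → Fin n → Set
Active []      c = ⊥
Active (x ∷ p) c = Active p c ⊎ (c ∈ p × x < c × ∀ g → ¬ (Active p g × x < g × g < c))

Active? : (p : List (Fin n)) (c : Fin n) → Dec (Active p c)
Active? []      c = no λ ()
Active? (x ∷ p) c = Active? p c ⊎-dec
  (anyL? (c ≟_) p ×-dec (x <? c ×-dec
    all? λ g → ¬? (Active? p g ×-dec (x <? g ×-dec g <? c))))

Active⇒∈ : (p : List (Fin n)) {c : Fin n} → Active p c → c ∈ p
Active⇒∈ (x ∷ p) (inj₁ a)       = there (Active⇒∈ p a)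
Active⇒∈ (x ∷ p) (inj₂ (c∈ , _)) = there c∈

-- Exchange steps in the two directions.

data Dir : Set where
  up down : Dir

opposite : Dir → Dir
opposite up   = down
opposite down = up

-- Lets one argument serve both rewriting systems. The direction only orients the two exchanged
-- letters; activation and the comparison with the later letter always use `<`.
_≺[_]_ : Fin n → Dir → Fin n → Set
x ≺[ up ]   y = x < y
x ≺[ down ] y = y < x

≺-dec : (d : Dir) (x y : Fin n) → Dec (x ≺[ d ] y)
≺-dec up   x y = x <? y
≺-dec down x y = y <? x

≺-trans : (d : Dir) {x y z : Fin n} → x ≺[ d ] y → y ≺[ d ] z → x ≺[ d ] z
≺-trans up   p q = <-trans p q
≺-trans down p q = <-trans q p

≺-asym : (d : Dir) {x y : Fin n} → x ≺[ d ] y → ¬ y ≺[ d ] x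
≺-asym up   p q = <-asym p q
≺-asym down p q = <-asym p q

≺-opposite : (d : Dir) {x y : Fin n} → x ≺[ d ] y → y ≺[ opposite d ] x
≺-opposite up   p = p
≺-opposite down p = p

-- The letter `l` is to be the last letter of a forbidden pattern, so it is sought in `v`, which
-- lies beyond both exchanged letters.
Separated : Dir → List (Fin n) → Vec (Fin n) m → Fin n → Fin n → Set
Separated d p v a b = ∃ λ g → Active p g × a ≺[ d ] g × g ≺[ d ] b × ∃ λ l → g < l × l ∷ [] ⊆ v

data Step {n} (d : Dir) (p : List (Fin n)) : Vec (Fin n) m → Vec (Fin n) m → Set where
  here  : ∀ {a b} {v : Vec (Fin n) m} → Separated d p v a b → Step d p (a ∷ b ∷ v) (b ∷ a ∷ v)
  there : ∀ {x} {v w : Vec (Fin n) m} → Step d (x ∷ p) v w → Step d p (x ∷ v) (x ∷ w)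

Separated? : (d : Dir) (p : List (Fin n)) (v : Vec (Fin n) m) (a b : Fin n) → Dec (Separated d p v a b)
Separated? d p v a b = any? λ g → Active? p g ×-dec (≺-dec d a g ×-dec (≺-dec d g b ×-dec
  any? λ l → g <? l ×-dec occurs? l v))

step? : (d : Dir) (p : List (Fin n)) (v : Vec (Fin n) m) → Dec (∃ (Step d p v))
step? d p []      = no λ { (_ , ()) }
step? d p (x ∷ []) = no λ { (_ , there ()) }
step? d p (x ∷ y ∷ v) with Separated? d p v x y | step? d (x ∷ p) (y ∷ v)
... | yes s | _           = yes (_ , here s)
... | no _  | yes (_ , s) = yes (_ , there s)
... | no ¬s | no ¬t       = no λ { (_ , here s) → ¬s s ; (_ , there t) → ¬t (_ , t) }

Separated-opposite : (d : Dir) {p : List (Fin n)} {v : Vec (Fin n) m} {a b : Fin n} →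
  Separated d p v a b → Separated (opposite d) p v b a
Separated-opposite d (g , act , ag , gb , l) = g , act , ≺-opposite d gb , ≺-opposite d ag , l

-- Local confluence.

infix 4 _∼_

-- A prefix influences steps only through its active letters; membership is recorded as well because
-- it governs what becomes active later.
record _∼_ (p q : List (Fin n)) : Set where
  field
    ∈-to        : ∀ {x} → x ∈ p → x ∈ q
    ∈-from      : ∀ {x} → x ∈ q → x ∈ p
    Active-to   : ∀ {x} → Active p x → Active q x
    Active-from : ∀ {x} → Active q x → Active p x

open _∼_

∼-sym : {p q : List (Fin n)} → p ∼ q → q ∼ p
∼-sym e = record { ∈-to = ∈-from e ; ∈-from = ∈-to e ; Active-to = Active-from e ; Active-from = Active-to e }

∼-∷ : {p q : List (Fin n)} (x : Fin n) → p ∼ q → x ∷ p ∼ x ∷ q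
∼-∷ x e = record { ∈-to = mem (∈-to e) ; ∈-from = mem (∈-from e) ; Active-to = act e ; Active-from = act (∼-sym e) }
  where
  mem : ∀ {p q} → (∀ {y} → y ∈ p → y ∈ q) → ∀ {y} → y ∈ x ∷ p → y ∈ x ∷ q
  mem f (here e)  = here e
  mem f (there i) = there (f i)
  act : ∀ {p q} → p ∼ q → ∀ {y} → Active (x ∷ p) y → Active (x ∷ q) y
  act e (inj₁ a)             = inj₁ (Active-to e a)
  act e (inj₂ (c∈ , lt , no-g)) = inj₂ (∈-to e c∈ , lt , λ { g (a , r) → no-g g (Active-from e a , r) })

Step-resp-∼ : (d : Dir) {p q : List (Fin n)} {v w : Vec (Fin n) m} → p ∼ q → Step d p v w → Step d q v w
Step-resp-∼ d e (here (g , act , r)) = here (g , Active-to e act , r)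
Step-resp-∼ d e (there s)            = there (Step-resp-∼ d (∼-∷ _ e) s)

-- Blocked by `g`, the letter `a` activates nothing above `g`, while `b` activates only letters
-- above `b`. Hence a letter activated by one never lies in the interval that would block the other,
-- and the order of reading is immaterial.
swap-∼< : {p : List (Fin n)} {a b g : Fin n} → Active p g → a < g → g < b → a ∷ b ∷ p ∼ b ∷ a ∷ p
swap-∼< {p = p} {a} {b} {g} ag a<g g<b = record { ∈-to = mem ; ∈-from = mem ; Active-to = to ; Active-from = from }
  where
  mem : ∀ {x y z : Fin _} → x ∈ y ∷ z ∷ p → x ∈ z ∷ y ∷ p
  mem (here e)          = there (here e)
  mem (there (here e))  = here e
  mem (there (there i)) = there (there i)
  below : ∀ {c} → a < c → (∀ h → ¬ (Active p h × a < h × h < c)) → ¬ b < c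
  below a<c no-h b<c = no-h g (ag , a<g , <-trans g<b b<c)
  to : ∀ {c} → Active (a ∷ b ∷ p) c → Active (b ∷ a ∷ p) c
  to (inj₁ (inj₁ ac)) = inj₁ (inj₁ ac)
  to (inj₁ (inj₂ (c∈ , b<c , no-h))) = inj₂ (there c∈ , b<c , λ
    { h (inj₁ ah , r) → no-h h (ah , r)
    ; h (inj₂ (_ , a<h , no-h') , b<h , _) → below a<h no-h' b<h })
  to (inj₂ (here refl , a<c , no-h)) = ⊥-elim (no-h g (inj₁ ag , a<g , g<b))
  to (inj₂ (there c∈ , a<c , no-h)) = inj₁ (inj₂ (c∈ , a<c , λ { h (ah , r) → no-h h (inj₁ ah , r) }))
  from : ∀ {c} → Active (b ∷ a ∷ p) c → Active (a ∷ b ∷ p) c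
  from (inj₁ (inj₁ ac)) = inj₁ (inj₁ ac)
  from (inj₁ (inj₂ (c∈ , a<c , no-h))) = inj₂ (there c∈ , a<c , λ
    { h (inj₁ ah , r) → no-h h (ah , r)
    ; h (inj₂ (_ , b<h , _) , _ , h<c) → below a<c no-h (<-trans b<h h<c) })
  from (inj₂ (here refl , b<c , no-h)) = ⊥-elim (<-asym b<c (<-trans a<g g<b))
  from (inj₂ (there c∈ , b<c , no-h)) = inj₁ (inj₂ (c∈ , b<c , λ { h (ah , r) → no-h h (inj₁ ah , r) }))

swap-∼ : (d : Dir) {p : List (Fin n)} {v : Vec (Fin n) m} {a b : Fin n} →
  Separated d p v a b → a ∷ b ∷ p ∼ b ∷ a ∷ p
swap-∼ up   (g , ag , a<g , g<b , _) = swap-∼< ag a<g g<b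
swap-∼ down (g , ag , g<a , b<g , _) = ∼-sym (swap-∼< ag b<g g<a)

-- The separating letter and the later letter do not depend on which of the exchanged letters comes
-- first.
Step-opposite : (d : Dir) {p : List (Fin n)} {v w : Vec (Fin n) m} → Step d p v w → Step (opposite d) p w v
Step-opposite d (here s)  = here (Separated-opposite d s)
Step-opposite d (there s) = there (Step-opposite d s)

Step-occurs : (d : Dir) {p : List (Fin n)} {v w : Vec (Fin n) m} {x : Fin n} →
  Step d p v w → x ∷ [] ⊆ v → x ∷ [] ⊆ w
Step-occurs d (here s)  (keep i)        = skip (keep ([]⊆ _))
Step-occurs d (here s)  (skip (keep i)) = keep ([]⊆ _)
Step-occurs d (here s)  (skip (skip i)) = skip (skip i)
Step-occurs d (there s) (keep i)        = keep ([]⊆ _)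
Step-occurs d (there s) (skip i)        = skip (Step-occurs d s i)

-- Reading `a` cannot be what activates `h`: upward, `g` blocks it; downward, `h` is smaller than
-- `a`.
Active-pred : (d : Dir) {p : List (Fin n)} {a g h : Fin n} → Active p g → a ≺[ d ] g → g ≺[ d ] h →
  Active (a ∷ p) h → Active p h
Active-pred d    ag a<g g<h (inj₁ ah)             = ah
Active-pred up   ag a<g g<h (inj₂ (_ , _ , no-g)) = ⊥-elim (no-g _ (ag , a<g , g<h))
Active-pred down ag g<a h<g (inj₂ (_ , a<h , _))  = ⊥-elim (<-asym a<h (<-trans h<g g<a))

Joinable : (d : Dir) (p : List (Fin n)) → Vec (Fin n) m → Vec (Fin n) m → Set
Joinable d p v w = ∃ λ z → Star (Step d p) v z × Star (Step d p) w z

join-sym : {d : Dir} {p : List (Fin n)} {v w : Vec (Fin n) m} → Joinable d p v w → Joinable d p w v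
join-sym (z , r , s) = z , s , r

-- Both sides of the overlap `a b c` reach `c b a`. Each of `g` and `h` also separates `a` from `c`,
-- which supplies the missing exchange, and `h` is already active before `a` is read.
join-triple : (d : Dir) {p : List (Fin n)} {v : Vec (Fin n) m} {a b c : Fin n} →
  Separated d p (c ∷ v) a b → Separated d (a ∷ p) v b c → Joinable d p (b ∷ a ∷ c ∷ v) (a ∷ c ∷ b ∷ v)
join-triple {n} d {p} {v} {a} {b} {c}
  (g , ag , a<g , g<b , l , g<l , l∈) (h , ah , b<h , h<c , l' , h<l' , l'∈) =
  c ∷ b ∷ a ∷ v ,
  there (here (g , inj₁ ag , a<g , ≺-trans d g<h h<c , later)) ◅
    here (h , ah₀ , b<h , h<c , l' , h<l' , skip l'∈) ◅ ε ,
  here (h , ah₀ , ≺-trans d a<g g<h , h<c , l' , h<l' , skip l'∈) ◅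
    there (here (g , inj₁ ag , a<g , g<b , later)) ◅ ε
  where
  g<h : g ≺[ d ] h
  g<h = ≺-trans d g<b b<h
  ah₀ : Active p h
  ah₀ = Active-pred d ag a<g g<h ah
  -- Going up, `l` may be `c`, so `l'` replaces it, which exceeds `h` and therefore `g`. Going down,
  -- `c < h < g` rules out `l = c`.
  beyond : (d : Dir) {l : Fin n} → g ≺[ d ] h → h ≺[ d ] c → g < l → l ∷ [] ⊆ c ∷ v → ∃ λ l → g < l × l ∷ [] ⊆ v
  beyond up   g<h h<c _   _         = l' , <-trans g<h h<l' , l'∈
  beyond down h<g c<h g<c (keep _)  = ⊥-elim (<-asym g<c (<-trans c<h h<g))
  beyond down _   _   g<l (skip l∈) = _ , g<l , l∈
  later : ∃ λ l → g < l × l ∷ [] ⊆ v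
  later = beyond d g<h h<c g<l l∈

Separated-step : (d : Dir) {p q : List (Fin n)} {v w : Vec (Fin n) m} {a b : Fin n} →
  Step d q v w → Separated d p v a b → Separated d p w a b
Separated-step d s (g , ag , a<g , g<b , l , g<l , l∈) = g , ag , a<g , g<b , l , g<l , Step-occurs d s l∈

-- Steps at the same place coincide, and steps sharing one letter are joined by `join-triple`.
-- Disjoint steps commute: the earlier exchange changes the prefix only up to `∼`, and the later one
-- only permutes the suffix in which `l` is sought.
locally-confluent : (d : Dir) {p : List (Fin n)} {u v w : Vec (Fin n) m} →
  Step d p u v → Step d p u w → Joinable d p v w
locally-confluent d (here s) (here t)          = _ , ε , ε
locally-confluent d (here s) (there (here t))  = join-triple d s t
locally-confluent d (there (here t)) (here s)  = join-sym (join-triple d s t)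
locally-confluent d (here s) (there (there t)) =
  _ , there (there (Step-resp-∼ d (∼-sym (swap-∼ d s)) t)) ◅ ε , here (Separated-step d t s) ◅ ε
locally-confluent d (there (there t)) (here s) =
  _ , here (Separated-step d t s) ◅ ε , there (there (Step-resp-∼ d (∼-sym (swap-∼ d s)) t)) ◅ ε
locally-confluent d (there s) (there t) with locally-confluent d s t
... | _ , r , r' = _ , gmap (_ ∷_) there r , gmap (_ ∷_) there r'

-- Termination, confluence and unique normal forms.

count : Dir → Fin n → Vec (Fin n) m → ℕ
count d x []      = 0
count d x (y ∷ v) with ≺-dec d x y
... | yes _ = suc (count d x v)
... | no  _ = count d x v

-- The non-inversions for `up`, the inversions for `down`.
pairs : Dir → Vec (Fin n) m → ℕ
pairs d []      = 0
pairs d (x ∷ v) = count d x v + pairs d v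

count-swap : (d : Dir) (x a b : Fin n) (v : Vec (Fin n) m) → count d x (a ∷ b ∷ v) ≡ count d x (b ∷ a ∷ v)
count-swap d x a b v with ≺-dec d x a in ea | ≺-dec d x b in eb
... | yes _ | yes _ rewrite ea | eb = refl
... | yes _ | no _  rewrite ea | eb = refl
... | no _  | yes _ rewrite ea | eb = refl
... | no _  | no _  rewrite ea | eb = refl

count-step : (d e : Dir) {p : List (Fin n)} (x : Fin n) {v w : Vec (Fin n) m} →
  Step d p v w → count e x v ≡ count e x w
count-step d e x (here {a = a} {b} {v} _) = count-swap e x a b v
count-step d e x (there {x = y} s) with ≺-dec e x y
... | yes _ = cong suc (count-step d e x s)
... | no _  = count-step d e x s

-- Exchanging neighbours keeps their order relative to all other letters, so exactly one counted
-- pair disappears.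
pairs-step : (d : Dir) {p : List (Fin n)} {v w : Vec (Fin n) m} → Step d p v w → pairs d w <ℕ pairs d v
pairs-step d (here {a = a} {b} {v} (g , _ , a<g , g<b , _)) with ≺-dec d a b | ≺-dec d b a
... | no ¬ab | _      = contradiction (≺-trans d a<g g<b) ¬ab
... | yes ab | yes ba = contradiction ba (≺-asym d ab)
... | yes _  | no _   = s≤s (≤-reflexive
  (trans (sym (+-assoc (count d b v) _ _))
    (trans (cong (_+ pairs d v) (+-comm (count d b v) (count d a v))) (+-assoc (count d a v) _ _))))
pairs-step d (there {x = x} {v} {w} s) rewrite count-step d d x s = +-monoʳ-< (count d x w) (pairs-step d s)

Rewrites : Dir → Vec (Fin n) m → Vec (Fin n) m → Set
Rewrites d = Step d []

strongly-normalizing : (d : Dir) → StronglyNormalizing (Plus (Rewrites {n} {m} d))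
strongly-normalizing d =
  WF.Subrelation.wellFounded (shrinks d) (On.wellFounded (pairs d) <-wellFounded)
  where
  shrinks : (d : Dir) {v w : Vec (Fin _) _} → Plus (Rewrites d) w v → pairs d v <ℕ pairs d w
  shrinks d [ s ]           = pairs-step d s
  shrinks d (_ ∼⁺⟨ r ⟩ s) = <ℕ-trans (shrinks d s) (shrinks d r)

confluent : (d : Dir) → Confluent (Rewrites {n} {m} d)
confluent d = sn&wcr⇒cr (strongly-normalizing d) (locally-confluent d)

normalize : (d : Dir) (v : Vec (Fin n) m) → HasNormalForm (Rewrites d) v
normalize d v = go v (strongly-normalizing d v)
  where
  go : (v : Vec (Fin _) _) → Acc (flip (Plus (Rewrites d))) v → HasNormalForm (Rewrites d) v
  go v (acc rec) with step? d [] v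
  ... | no ¬s       = v , ¬s , ε
  ... | yes (w , s) with go w (rec [ s ])
  ...   | z , nf , r = z , nf , s ◅ r

normal-unique : (d : Dir) {u v w : Vec (Fin n) m} → IsNormalForm (Rewrites d) v → IsNormalForm (Rewrites d) w →
  Star (Rewrites d) u v → Star (Rewrites d) u w → v ≡ w
normal-unique d nv nw r s with confluent d r s
... | _ , ε      , ε      = refl
... | _ , t ◅ _  , _      = contradiction (_ , t) nv
... | _ , ε      , t ◅ _  = contradiction (_ , t) nw

-- From forbidden subwords to applicable steps.

≺-connex : (d : Dir) {x y : Fin n} → ¬ x ≡ y → x ≺[ d ] y ⊎ y ≺[ d ] x
≺-connex d {x} {y} x≢y with <-cmp x y
≺-connex up   x≢y | tri< p _ _ = inj₁ p
≺-connex down x≢y | tri< p _ _ = inj₂ p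
≺-connex d    x≢y | tri≈ _ e _ = contradiction e x≢y
≺-connex up   x≢y | tri> _ _ p = inj₂ p
≺-connex down x≢y | tri> _ _ p = inj₁ p

Distinct : Vec (Fin n) m → Set
Distinct w = ∀ x → ¬ (x ∷ x ∷ [] ⊆ w)

Disjoint : List (Fin n) → Vec (Fin n) m → Set
Disjoint p w = ∀ {x} → x ∈ p → ¬ (x ∷ [] ⊆ w)

Distinct-tail : {x : Fin n} {w : Vec (Fin n) m} → Distinct (x ∷ w) → Distinct w
Distinct-tail D y i = D y (skip i)

Disjoint-∷ : {p : List (Fin n)} {x : Fin n} {w : Vec (Fin n) m} →
  Distinct (x ∷ w) → Disjoint p (x ∷ w) → Disjoint (x ∷ p) w
Disjoint-∷ D P (here refl) i = D _ (keep i)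
Disjoint-∷ D P (there x∈)  i = P x∈ (skip i)

step-there : {d : Dir} {p : List (Fin n)} {x : Fin n} {v : Vec (Fin n) m} → ∃ (Step d (x ∷ p) v) → ∃ (Step d p (x ∷ v))
step-there (_ , s) = _ , there s

-- On the way from `x` to `y` no letter equals `g`, which has been read already, so the side of `g`
-- changes between two neighbours. These can be exchanged, as `l` still follows them.
crossing⇒step : (d : Dir) {p : List (Fin n)} (w : Vec (Fin n) m) {g x y l : Fin n} →
  Distinct w → Disjoint p w → Active p g → x ∷ y ∷ l ∷ [] ⊆ w →
  x ≺[ d ] g → g ≺[ d ] y → g < l → ∃ (Step d p w)
crossing⇒step d (z ∷ w) D P ag (skip i) x<g g<y g<l =
  step-there (crossing⇒step d w (Distinct-tail D) (Disjoint-∷ D P) (inj₁ ag) i x<g g<y g<l)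
crossing⇒step d (x ∷ y ∷ w) D P ag (keep (keep i)) x<g g<y g<l = _ , here (_ , ag , x<g , g<y , _ , g<l , i)
crossing⇒step d {p} (x ∷ z ∷ w) {g} D P ag (keep (skip i)) x<g g<y g<l =
  [ (λ z<g → step-there (crossing⇒step d (z ∷ w) (Distinct-tail D) (Disjoint-∷ D P) (inj₁ ag) (keep i) z<g g<y g<l))
  , (λ g<z → _ , here (_ , ag , x<g , g<z , _ , g<l , ⊆-trans (skip (keep [])) i))
  ]′ (≺-connex d λ { refl → P (Active⇒∈ p ag) (skip (keep ([]⊆ w))) })

activated-or-blocked : (p : List (Fin n)) {c s : Fin n} → c ∈ p → s < c →
  Active (s ∷ p) c ⊎ ∃ λ g → Active p g × s < g × g < c
activated-or-blocked p {c} {s} c∈ s<c with any? (λ g → Active? p g ×-dec (s <? g ×-dec g <? c))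
... | yes blocked = inj₂ blocked
... | no ¬blocked = inj₁ (inj₂ (c∈ , s<c , λ g r → ¬blocked (g , r)))

-- While c stays inactive, the largest active letter below c is the one that was there when c was read.
active-below : (u p : List (Fin n)) {c g : Fin n} → Active (u ++ c ∷ p) g → g < c →
  Active (u ++ c ∷ p) c ⊎ ∃ λ h → Active p h × h < c × ¬ h < g
active-below []      p (inj₁ ag)            g<c = inj₂ (_ , ag , g<c , <-irrefl refl)
active-below []      p (inj₂ (_ , c<g , _)) g<c = contradiction c<g (<-asym g<c)
active-below (x ∷ u) p (inj₁ ag) g<c with active-below u p ag g<c
... | inj₁ ac = inj₁ (inj₁ ac)
... | inj₂ r  = inj₂ r
active-below (x ∷ u) p {c} {g} (inj₂ (_ , x<g , none)) g<c
  with activated-or-blocked (u ++ c ∷ p) (∈-insert u) (<-trans x<g g<c)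
... | inj₁ ac = inj₁ ac
... | inj₂ (k , ak , x<k , k<c) with active-below u p ak k<c
...   | inj₁ ac = inj₁ (inj₁ ac)
...   | inj₂ (h , ah , h<c , h≮k) = inj₂ (h , ah , h<c , h≮g)
  where
  -- If `h < g`, then `k < g` too, as `h` is not below `k`; but then `k` would have kept `x` from
  -- activating `g`.
  h≮g : ¬ h < g
  h≮g h<g with <-cmp h k
  ... | tri< h<k _ _  = h≮k h<k
  ... | tri≈ _ refl _ = none k (ak , x<k , h<g)
  ... | tri> _ _ k<h  = none k (ak , x<k , <-trans k<h h<g)

-- If `s₁` activates `c`, then `s₂ … l₁` crosses `c`. Otherwise an active `g` with `s₁ < g < c`
-- blocks it, and `g` is crossed instead: by `s₁ … s₂` when `g < s₂`, by `s₂ … l₁` when `s₂ < g`.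
ssll⇒step-up : {p : List (Fin n)} (w : Vec (Fin n) m) {c s₁ s₂ l₁ l₂ : Fin n} → Distinct w → Disjoint p w → c ∈ p →
  s₁ ∷ s₂ ∷ l₁ ∷ l₂ ∷ [] ⊆ w → s₁ < c → s₂ < c → c < l₁ → c < l₂ → ∃ (Step up p w)
ssll⇒step-up (x ∷ w) D P c∈ (skip i) s₁< s₂< <l₁ <l₂ =
  step-there (ssll⇒step-up w (Distinct-tail D) (Disjoint-∷ D P) (there c∈) i s₁< s₂< <l₁ <l₂)
ssll⇒step-up {p = p} (s₁ ∷ w) {s₂ = s₂} D P c∈ (keep i) s₁< s₂< <l₁ <l₂ with activated-or-blocked p c∈ s₁<
... | inj₁ ac = step-there (crossing⇒step up w (Distinct-tail D) (Disjoint-∷ D P) ac i s₂< <l₁ <l₂)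
... | inj₂ (g , ag , s₁<g , g<c) with <-cmp s₂ g
...   | tri≈ _ refl _ = contradiction (skip (⊆-trans (keep (skip (skip []))) i)) (P (Active⇒∈ p ag))
...   | tri> _ _ g<s₂ =
  crossing⇒step up (s₁ ∷ w) D P ag (keep (⊆-trans (keep (keep (skip []))) i)) s₁<g g<s₂ (<-trans g<c <l₁)
...   | tri< s₂<g _ _ =
  step-there (crossing⇒step up w (Distinct-tail D) (Disjoint-∷ D P) (inj₁ ag) i s₂<g (<-trans g<c <l₁) (<-trans g<c <l₂))

cssll⇒step-up : {p : List (Fin n)} (w : Vec (Fin n) m) {c s₁ s₂ l₁ l₂ : Fin n} → Distinct w → Disjoint p w →
  c ∷ s₁ ∷ s₂ ∷ l₁ ∷ l₂ ∷ [] ⊆ w → s₁ < c → s₂ < c → c < l₁ → c < l₂ → ∃ (Step up p w)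
cssll⇒step-up (x ∷ w) D P (skip i) s₁< s₂< <l₁ <l₂ =
  step-there (cssll⇒step-up w (Distinct-tail D) (Disjoint-∷ D P) i s₁< s₂< <l₁ <l₂)
cssll⇒step-up (c ∷ w) D P (keep i) s₁< s₂< <l₁ <l₂ =
  step-there (ssll⇒step-up w (Distinct-tail D) (Disjoint-∷ D P) (here refl) i s₁< s₂< <l₁ <l₂)

-- If `c` is active once `s₁` is read, then `l₁ … s₂` crosses it. If `g` blocks `s₁`, the letters
-- `l₁`, `s₂`, `l₂` may all exceed `g`, and then only `c` itself can serve as the large letter ahead
-- of `s₁`. For that the separating letter must predate `c`, whence the split `u ++ c ∷ p` and the
-- second alternative.
slsl⇒step-down : (u p : List (Fin n)) (w : Vec (Fin n) m) {c s₁ l₁ s₂ l₂ : Fin n} →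
  Distinct w → Disjoint (u ++ c ∷ p) w → s₁ ∷ l₁ ∷ s₂ ∷ l₂ ∷ [] ⊆ w → s₁ < c → c < l₁ → s₂ < c → c < l₂ →
  ∃ (Step down (u ++ c ∷ p) w) ⊎ ∃ λ h → Active p h × s₁ < h × h < c
slsl⇒step-down u p (x ∷ w) D P (skip i) s₁< <l₁ s₂< <l₂
  with slsl⇒step-down (x ∷ u) p w (Distinct-tail D) (Disjoint-∷ D P) i s₁< <l₁ s₂< <l₂
... | inj₁ (_ , s) = inj₁ (_ , there s)
... | inj₂ r       = inj₂ r
slsl⇒step-down u p (s₁ ∷ w) {c} D P (keep i) s₁< <l₁ s₂< <l₂ = [ active , blocked ]′ (activated-or-blocked q (∈-insert u) s₁<)
  where
  q = u ++ c ∷ p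
  active : Active (s₁ ∷ q) c → ∃ (Step down q (s₁ ∷ w)) ⊎ ∃ λ h → Active p h × s₁ < h × h < c
  active ac with crossing⇒step down w (Distinct-tail D) (Disjoint-∷ D P) ac i <l₁ s₂< <l₂
  ... | _ , s = inj₁ (_ , there s)
  blocked : (∃ λ g → Active q g × s₁ < g × g < c) → ∃ (Step down q (s₁ ∷ w)) ⊎ ∃ λ h → Active p h × s₁ < h × h < c
  blocked (g , ag , s₁<g , g<c) with active-below u p ag g<c
  ... | inj₁ ac = active (inj₁ ac)
  ... | inj₂ (h , ah , h<c , h≮g) with <-cmp g h
  ...   | tri< g<h _ _  = inj₂ (h , ah , <-trans s₁<g g<h , h<c)
  ...   | tri≈ _ refl _ = inj₂ (h , ah , s₁<g , h<c)
  ...   | tri> _ _ h<g  = contradiction h<g h≮g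

cslsl⇒step-down : {p : List (Fin n)} (w : Vec (Fin n) m) {c s₁ l₁ s₂ l₂ : Fin n} → Distinct w → Disjoint p w →
  c ∷ s₁ ∷ l₁ ∷ s₂ ∷ l₂ ∷ [] ⊆ w → s₁ < c → c < l₁ → s₂ < c → c < l₂ → ∃ (Step down p w)
cslsl⇒step-down (x ∷ w) D P (skip i) s₁< <l₁ s₂< <l₂ =
  step-there (cslsl⇒step-down w (Distinct-tail D) (Disjoint-∷ D P) i s₁< <l₁ s₂< <l₂)
cslsl⇒step-down {p = p} (c ∷ w) D P (keep i) s₁< <l₁ s₂< <l₂
  with slsl⇒step-down [] p w (Distinct-tail D) (Disjoint-∷ D P) i s₁< <l₁ s₂< <l₂
... | inj₁ (_ , s) = _ , there s
-- Here `c … s₁` crosses `h`, with `l₂` as the later letter.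
... | inj₂ (h , ah , s₁<h , h<c) =
  crossing⇒step down (c ∷ w) D P ah (keep (⊆-trans (keep (skip (skip (keep [])))) i)) h<c s₁<h (<-trans h<c <l₂)

-- Subwords and index maps.

lookup-⊆ : (w : Vec (Fin n) m) (i : Fin m) → lookup w i ∷ [] ⊆ w
lookup-⊆ (x ∷ w) zero    = keep ([]⊆ w)
lookup-⊆ (x ∷ w) (suc i) = skip (lookup-⊆ w i)

lookup-⊆₂ : (w : Vec (Fin n) m) {i j : Fin m} → i < j → lookup w i ∷ lookup w j ∷ [] ⊆ w
lookup-⊆₂ (x ∷ w) {zero}  {suc j} _         = keep (lookup-⊆ w j)
lookup-⊆₂ (x ∷ w) {suc i} {suc j} (s≤s i<j) = skip (lookup-⊆₂ w i<j)

-- Connects subwords, which suit recursion on the word, with the index maps used by `Contains`.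
record Embedding (u : Vec (Fin n) k) (w : Vec (Fin n) m) : Set where
  constructor embedding
  field
    index  : Fin k → Fin m
    mono   : ∀ a b → a < b → index a < index b
    agrees : ∀ a → lookup w (index a) ≡ lookup u a

open Embedding

⊆⇒Embedding : {u : Vec (Fin n) k} {w : Vec (Fin n) m} → u ⊆ w → Embedding u w
⊆⇒Embedding [] = embedding (λ ()) (λ ()) λ ()
⊆⇒Embedding (skip i) with ⊆⇒Embedding i
... | embedding f f-mono f-agrees = embedding (suc ∘ f) (λ a b a<b → s≤s (f-mono a b a<b)) f-agrees
⊆⇒Embedding (keep i) with ⊆⇒Embedding i
... | embedding f f-mono f-agrees = embedding
  (λ { zero → zero ; (suc a) → suc (f a) })
  (λ { zero (suc b) _ → s≤s z≤n ; (suc a) (suc b) (s≤s a<b) → s≤s (f-mono a b a<b) })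
  (λ { zero → refl ; (suc a) → f-agrees a })

Embedding-tail : {u : Vec (Fin n) k} {x : Fin n} {w : Vec (Fin n) m} →
  (e : Embedding u (x ∷ w)) → (∀ a → 0 <ℕ toℕ (index e a)) → Embedding u w
Embedding-tail {k = k} {m = m} {x = x} {w} (embedding f f-mono f-agrees) f>0 = embedding
  (proj₁ ∘ shift)
  (λ a b a<b → s<s⁻¹ (subst₂ _<_ (proj₂ (shift a)) (proj₂ (shift b)) (f-mono a b a<b)))
  (λ a → trans (sym (cong (lookup (x ∷ w)) (proj₂ (shift a)))) (f-agrees a))
  where
  predecessor : (i : Fin (suc m)) → 0 <ℕ toℕ i → ∃ λ j → i ≡ suc j
  predecessor (suc j) _ = j , refl
  shift : (a : Fin k) → ∃ λ j → f a ≡ suc j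
  shift a = predecessor (f a) (f>0 a)

Embedding⇒⊆ : (u : Vec (Fin n) k) (w : Vec (Fin n) m) → Embedding u w → u ⊆ w
Embedding⇒⊆ []      w       e = []⊆ w
Embedding⇒⊆ (y ∷ u) []      e with () ← index e zero
Embedding⇒⊆ (y ∷ u) (x ∷ w) (embedding f f-mono f-agrees) with f zero in eq
... | suc i = skip (Embedding⇒⊆ (y ∷ u) w (Embedding-tail (embedding f f-mono f-agrees) λ
  { zero    → subst (λ j → 0 <ℕ toℕ j) (sym eq) (s≤s z≤n)
  ; (suc a) → m<n⇒0<n (f-mono zero (suc a) (s≤s z≤n)) }))
... | zero with refl ← trans (cong (lookup (x ∷ w)) (sym eq)) (f-agrees zero) =
  keep (Embedding⇒⊆ u w (Embedding-tail
    (embedding (f ∘ suc) (λ a b a<b → f-mono (suc a) (suc b) (s≤s a<b)) (f-agrees ∘ suc))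
    λ a → m<n⇒0<n (f-mono zero (suc a) (s≤s z≤n))))

⊆⇒indices : {w : Vec (Fin n) m} {x y : Fin n} → x ∷ y ∷ [] ⊆ w → ∃₂ λ i j → i < j × lookup w i ≡ x × lookup w j ≡ y
⊆⇒indices i with ⊆⇒Embedding i
... | embedding f f-mono f-agrees = f zero , f (suc zero) , f-mono _ _ (s≤s z≤n) , f-agrees zero , f-agrees (suc zero)

⊆⇒index : {w : Vec (Fin n) m} {x : Fin n} → x ∷ [] ⊆ w → ∃ λ i → lookup w i ≡ x
⊆⇒index i with ⊆⇒Embedding i
... | embedding f _ f-agrees = f zero , f-agrees zero

IsPerm⇒Distinct : {w : Word n} → IsPerm w → Distinct w
IsPerm⇒Distinct perm x i with ⊆⇒indices i
... | j , k , j<k , ej , ek = <-irrefl (perm j k (trans ej (sym ek))) j<k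

Distinct⇒IsPerm : (w : Word n) → Distinct w → IsPerm w
Distinct⇒IsPerm w D i j e with <-cmp i j
... | tri≈ _ i≡j _ = i≡j
... | tri< i<j _ _ = ⊥-elim (D _ (subst (λ x → x ∷ lookup w j ∷ [] ⊆ w) e (lookup-⊆₂ w i<j)))
... | tri> _ _ j<i = ⊥-elim (D _ (subst (λ x → lookup w j ∷ x ∷ [] ⊆ w) e (lookup-⊆₂ w j<i)))

contains-order : (w : Word n) (q : Vec ℕ k) ((f , _) : Contains w q) (a b : Fin k) →
  lookup q a <ℕ lookup q b → lookup w (f a) < lookup w (f b)
contains-order w q (_ , _ , iso) a b = Equivalence.from (iso a b)

contains-⊆ : (w : Word n) (q : Vec ℕ k) ((f , _) : Contains w q) → tabulate (lookup w ∘ f) ⊆ w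
contains-⊆ w q (f , f-mono , _) = Embedding⇒⊆ _ w (embedding f f-mono λ a → sym (lookup∘tabulate (lookup w ∘ f) a))

-- Normal forms avoid the patterns.

pattern #0 = zero
pattern #1 = suc #0
pattern #2 = suc #1
pattern #3 = suc #2
pattern #4 = suc #3

normal⇒InClassA : {w : Word n} → IsPerm w → IsNormalForm (Rewrites up) w → InClassA w
normal⇒InClassA {w = w} perm nf = perm ,
  avoids (3 ∷ 1 ∷ 2 ∷ 4 ∷ 5 ∷ []) ,
  avoids (3 ∷ 2 ∷ 1 ∷ 4 ∷ 5 ∷ []) ,
  avoids (3 ∷ 1 ∷ 2 ∷ 5 ∷ 4 ∷ []) ,
  avoids (3 ∷ 2 ∷ 1 ∷ 5 ∷ 4 ∷ [])
  where
  -- Only comparisons with the first letter of the pattern enter, so one argument covers all four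
  -- patterns; evaluation settles the `True` arguments.
  avoids : (q : Vec ℕ 5)
    {_ : True (lookup q #1 <ℕ? lookup q #0)} {_ : True (lookup q #2 <ℕ? lookup q #0)}
    {_ : True (lookup q #0 <ℕ? lookup q #3)} {_ : True (lookup q #0 <ℕ? lookup q #4)} → Avoids w q
  avoids q {t₁} {t₂} {t₃} {t₄} C = nf (cssll⇒step-up w (IsPerm⇒Distinct perm) (λ ()) (contains-⊆ w q C)
    (contains-order w q C #1 #0 (toWitness t₁)) (contains-order w q C #2 #0 (toWitness t₂))
    (contains-order w q C #0 #3 (toWitness t₃)) (contains-order w q C #0 #4 (toWitness t₄)))

normal⇒InClassB : {w : Word n} → IsPerm w → IsNormalForm (Rewrites down) w → InClassB w
normal⇒InClassB {w = w} perm nf = perm ,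
  avoids (3 ∷ 1 ∷ 4 ∷ 2 ∷ 5 ∷ []) ,
  avoids (3 ∷ 2 ∷ 4 ∷ 1 ∷ 5 ∷ []) ,
  avoids (3 ∷ 1 ∷ 5 ∷ 2 ∷ 4 ∷ []) ,
  avoids (3 ∷ 2 ∷ 5 ∷ 1 ∷ 4 ∷ [])
  where
  avoids : (q : Vec ℕ 5)
    {_ : True (lookup q #1 <ℕ? lookup q #0)} {_ : True (lookup q #0 <ℕ? lookup q #2)}
    {_ : True (lookup q #3 <ℕ? lookup q #0)} {_ : True (lookup q #0 <ℕ? lookup q #4)} → Avoids w q
  avoids q {t₁} {t₂} {t₃} {t₄} C = nf (cslsl⇒step-down w (IsPerm⇒Distinct perm) (λ ()) (contains-⊆ w q C)
    (contains-order w q C #1 #0 (toWitness t₁)) (contains-order w q C #0 #2 (toWitness t₂))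
    (contains-order w q C #3 #0 (toWitness t₃)) (contains-order w q C #0 #4 (toWitness t₄)))

-- Members of the classes are normal forms.

-- Here `σ` is the pattern with letters counted from 0 and `r` lists the occurring values in
-- increasing order, so a chain of neighbouring inequalities decides every comparison.
contains : {w : Word n} (σ : Vec (Fin k) k) {r : Vec (Fin n) k} → Linked _<_ r → map (lookup r) σ ⊆ w →
  Contains w (map (suc ∘ toℕ) σ)
contains {w = w} σ {r} sorted i with ⊆⇒Embedding i
... | embedding f f-mono f-agrees = f , f-mono , λ a b →
  mk⇔ (λ lt → subst₂ _<ℕ_ (rank a) (rank b) (s≤s (reflects (subst₂ _<_ (value a) (value b) lt))))
      (λ lt → subst₂ _<_ (sym (value a)) (sym (value b))
                (lookup⁺ <-trans sorted (s<s⁻¹ (subst₂ _<ℕ_ (sym (rank a)) (sym (rank b)) lt))))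
  where
  value : ∀ a → lookup w (f a) ≡ lookup r (lookup σ a)
  value a = trans (f-agrees a) (lookup-map a (lookup r) σ)
  rank : ∀ a → suc (toℕ (lookup σ a)) ≡ lookup (map (suc ∘ toℕ) σ) a
  rank a = sym (lookup-map a (suc ∘ toℕ) σ)
  reflects : ∀ {x y} → lookup r x < lookup r y → x < y
  reflects {x} {y} lt with <-cmp x y
  ... | tri< x<y _ _  = x<y
  ... | tri≈ _ refl _ = contradiction lt (<-irrefl refl)
  ... | tri> _ _ y<x  = contradiction lt (<-asym (lookup⁺ <-trans sorted y<x))

-- Tracks how much of the activation of `g` lies in the unread word: none of it, only a smaller
-- letter, or `g` and a smaller letter. Blocking is forgotten, since only the pattern is to be
-- recovered.
Location : List (Fin n) → Fin n → Vec (Fin n) k → Vec (Fin n) m → Set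
Location p g u v = (Active p g × u ⊆ v) ⊎ (g ∈ p × ∃ λ s → s < g × s ∷ u ⊆ v) ⊎ (∃ λ s → s < g × g ∷ s ∷ u ⊆ v)

Location-tail : {p : List (Fin n)} {x g : Fin n} {u : Vec (Fin n) k} {v : Vec (Fin n) m} →
  Location (x ∷ p) g u v → Location p g u (x ∷ v)
Location-tail (inj₁ (inj₁ ag , i))               = inj₁ (ag , skip i)
Location-tail (inj₁ (inj₂ (g∈ , x<g , _) , i))   = inj₂ (inj₁ (g∈ , _ , x<g , keep i))
Location-tail (inj₂ (inj₁ (here refl , s , s<g , i))) = inj₂ (inj₂ (s , s<g , keep i))
Location-tail (inj₂ (inj₁ (there g∈ , s , s<g , i))) = inj₂ (inj₁ (g∈ , s , s<g , skip i))
Location-tail (inj₂ (inj₂ (s , s<g , i)))        = inj₂ (inj₂ (s , s<g , skip i))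

-- The fields `forth` and `back` say that a single pair changes its order. They speak of letters
-- rather than positions, since positions shift.
record Exchange (d : Dir) (p : List (Fin n)) (v w : Vec (Fin n) m) : Set where
  field
    {g a b l} : Fin n
    a≺g       : a ≺[ d ] g
    g≺b       : g ≺[ d ] b
    g<l       : g < l
    location  : Location p g (a ∷ b ∷ l ∷ []) v
    forth     : ∀ {x y} → x ∷ y ∷ [] ⊆ v → x ∷ y ∷ [] ⊆ w ⊎ (x ≡ a × y ≡ b)
    back      : ∀ {x y} → x ∷ y ∷ [] ⊆ w → x ∷ y ∷ [] ⊆ v ⊎ (x ≡ b × y ≡ a)

exchange : (d : Dir) {p : List (Fin n)} {v w : Vec (Fin n) m} → Step d p v w → Exchange d p v w
exchange {n} d (here (g , ag , a≺g , g≺b , l , g<l , i)) = record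
  { a≺g = a≺g ; g≺b = g≺b ; g<l = g<l ; location = inj₁ (ag , keep (keep i)) ; forth = swapped ; back = swapped }
  where
  swapped : ∀ {m} {v : Vec (Fin n) m} {a b x y} →
    x ∷ y ∷ [] ⊆ a ∷ b ∷ v → x ∷ y ∷ [] ⊆ b ∷ a ∷ v ⊎ (x ≡ a × y ≡ b)
  swapped (keep (keep i))  = inj₂ (refl , refl)
  swapped (keep (skip i))  = inj₁ (skip (keep i))
  swapped (skip (keep i))  = inj₁ (keep (skip i))
  swapped (skip (skip i))  = inj₁ (skip (skip i))
exchange d (there s) = record
  { a≺g = a≺g ; g≺b = g≺b ; g<l = g<l ; location = Location-tail location
  ; forth = λ { (keep i) → inj₁ (keep (Step-occurs d s i)) ; (skip i) → map₁ skip (forth i) }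
  ; back  = λ { (keep i) → inj₁ (keep (Step-occurs (opposite d) (Step-opposite d s) i)) ; (skip i) → map₁ skip (back i) }
  }
  where open Exchange (exchange d s)

module Exchanged {d : Dir} {v w : Vec (Fin n) m} (s : Step d [] v w) where
  open Exchange (exchange d s) public

  occurrence : ∃ λ s → s < g × g ∷ s ∷ a ∷ b ∷ l ∷ [] ⊆ v
  -- Over the empty prefix nothing has been read, which leaves the third location.
  occurrence with location
  ... | inj₂ (inj₂ r) = r

  small : Fin n
  small = proj₁ occurrence

  small<g : small < g
  small<g = proj₁ (proj₂ occurrence)

  pattern-⊆ : g ∷ small ∷ a ∷ b ∷ l ∷ [] ⊆ v
  pattern-⊆ = proj₂ (proj₂ occurrence)

-- A step exhibits `g`, `small`, `a`, `b`, `l` in this order. Comparing `small` with `a` and `b`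
-- with `l` selects one of the four patterns.
InClassA⇒normal : {w : Word n} → InClassA w → IsNormalForm (Rewrites up) w
InClassA⇒normal {w = w} (perm , ¬31245 , ¬32145 , ¬31254 , ¬32154) (_ , s) =
  [ (λ s<a → [ (λ b<l → ¬31245 (contains (#2 ∷ #0 ∷ #1 ∷ #3 ∷ #4 ∷ []) (s<a ∷ a≺g ∷ g≺b ∷ b<l ∷ [-]) pattern-⊆))
             , (λ l<b → ¬31254 (contains (#2 ∷ #0 ∷ #1 ∷ #4 ∷ #3 ∷ []) (s<a ∷ a≺g ∷ g<l ∷ l<b ∷ [-]) pattern-⊆)) ]′ b≶l)
  , (λ a<s → [ (λ b<l → ¬32145 (contains (#2 ∷ #1 ∷ #0 ∷ #3 ∷ #4 ∷ []) (a<s ∷ small<g ∷ g≺b ∷ b<l ∷ [-]) pattern-⊆))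
             , (λ l<b → ¬32154 (contains (#2 ∷ #1 ∷ #0 ∷ #4 ∷ #3 ∷ []) (a<s ∷ small<g ∷ g<l ∷ l<b ∷ [-]) pattern-⊆)) ]′ b≶l)
  ]′ s≶a
  where
  open Exchanged s
  s≶a : small < a ⊎ a < small
  s≶a = ≺-connex up λ e → IsPerm⇒Distinct perm a
    (subst (λ x → x ∷ a ∷ [] ⊆ w) e (⊆-trans (skip (keep (keep (skip (skip []))))) pattern-⊆))
  b≶l : b < l ⊎ l < b
  b≶l = ≺-connex up λ e → IsPerm⇒Distinct perm l
    (subst (λ x → x ∷ l ∷ [] ⊆ w) e (⊆-trans (skip (skip (skip (keep (keep []))))) pattern-⊆))

-- Downward `a` is the large and `b` the small exchanged letter, so the open comparisons are `small`
-- with `b` and `a` with `l`.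
InClassB⇒normal : {w : Word n} → InClassB w → IsNormalForm (Rewrites down) w
InClassB⇒normal {w = w} (perm , ¬31425 , ¬32415 , ¬31524 , ¬32514) (_ , s) =
  [ (λ s<b → [ (λ a<l → ¬31425 (contains (#2 ∷ #0 ∷ #3 ∷ #1 ∷ #4 ∷ []) (s<b ∷ g≺b ∷ a≺g ∷ a<l ∷ [-]) pattern-⊆))
             , (λ l<a → ¬31524 (contains (#2 ∷ #0 ∷ #4 ∷ #1 ∷ #3 ∷ []) (s<b ∷ g≺b ∷ g<l ∷ l<a ∷ [-]) pattern-⊆)) ]′ a≶l)
  , (λ b<s → [ (λ a<l → ¬32415 (contains (#2 ∷ #1 ∷ #3 ∷ #0 ∷ #4 ∷ []) (b<s ∷ small<g ∷ a≺g ∷ a<l ∷ [-]) pattern-⊆))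
             , (λ l<a → ¬32514 (contains (#2 ∷ #1 ∷ #4 ∷ #0 ∷ #3 ∷ []) (b<s ∷ small<g ∷ g<l ∷ l<a ∷ [-]) pattern-⊆)) ]′ a≶l)
  ]′ s≶b
  where
  open Exchanged s
  s≶b : small < b ⊎ b < small
  s≶b = ≺-connex up λ e → IsPerm⇒Distinct perm b
    (subst (λ x → x ∷ b ∷ [] ⊆ w) e (⊆-trans (skip (keep (skip (keep (skip []))))) pattern-⊆))
  a≶l : a < l ⊎ l < a
  a≶l = ≺-connex up λ e → IsPerm⇒Distinct perm l
    (subst (λ x → x ∷ l ∷ [] ⊆ w) e (⊆-trans (skip (skip (keep (skip (keep []))))) pattern-⊆))

-- Preservation of the five statistics.

between-≢ : (d : Dir) {x y z : Fin n} → x ≺[ d ] y → y ≺[ d ] z → ¬ x ≡ z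
between-≢ d p q refl = ≺-asym d p q

Distinct-step : {d : Dir} {v w : Vec (Fin n) m} → Step d [] v w → Distinct v → Distinct w
Distinct-step {d = d} s D x i with Exchanged.back s i
... | inj₁ j           = D x j
... | inj₂ (x≡b , x≡a) = between-≢ d a≺g g≺b (trans (sym x≡a) x≡b)
  where open Exchanged s

IsPerm-step : {d : Dir} {v w : Word n} → Rewrites d v w → IsPerm v → IsPerm w
IsPerm-step {w = w} s perm = Distinct⇒IsPerm w (Distinct-step s (IsPerm⇒Distinct perm))

transfer : {d : Dir} {v w : Word n} → Rewrites d v w → (i : Fin n) → ∃ λ j → lookup w j ≡ lookup v i
transfer {d = d} {v} s i = ⊆⇒index (Step-occurs d s (lookup-⊆ v i))

before-related : {w : Word n} → IsPerm w → (R : Fin n → Fin n → Set) {i : Fin n} {y : Fin n} →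
  (∀ j → j < i → R (lookup w j) (lookup w i)) → y ∷ lookup w i ∷ [] ⊆ w → R y (lookup w i)
before-related perm R r t with ⊆⇒indices t
... | j , k , j<k , refl , ek = r j (subst (j <_) (perm _ _ ek) j<k)

after-related : {w : Word n} → IsPerm w → (R : Fin n → Fin n → Set) {i : Fin n} {y : Fin n} →
  (∀ j → i < j → R (lookup w j) (lookup w i)) → lookup w i ∷ y ∷ [] ⊆ w → R y (lookup w i)
after-related perm R r t with ⊆⇒indices t
... | j , k , j<k , ej , refl = r k (subst (_< k) (perm _ _ ej) j<k)

Preserved : (∀ {n} → Word n → ℕ → Set) → Set
Preserved S = ∀ {n} (d : Dir) {v w : Word n} → IsPerm v → Rewrites d v w → ∀ {k} → S v k → S w k

-- The reverse of a step is a step in the opposite direction, so one inclusion for both directions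
-- yields equality.
Preserved⇒SameSet : (S : ∀ {n} → Word n → ℕ → Set) → Preserved S → (d : Dir) {v w : Word n} →
  IsPerm v → Star (Rewrites d) v w → SameSet (S w) (S v)
Preserved⇒SameSet S pres d perm ε        k = mk⇔ (λ x → x) (λ x → x)
Preserved⇒SameSet S pres d perm (s ◅ ss) k = mk⇔
  (pres (opposite d) perm′ (Step-opposite d s) ∘ Equivalence.to rest)
  (Equivalence.from rest ∘ pres d perm s)
  where
  perm′ = IsPerm-step s perm
  rest  = Preserved⇒SameSet S pres d perm′ ss k

relabel : {w w′ : Word n} {i i′ : Fin n} {k : ℕ} → lookup w′ i′ ≡ lookup w i → val w i ≡ k → val w′ i′ ≡ k
relabel e refl = cong (suc ∘ toℕ) e

-- The only new pair is `b` before `a`. If `a` is a record, it compares correctly with `g`, which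
-- precedes it already, and `cross` passes from `g` to `b`.
prefix-preserved : (R : ∀ {n} → Fin n → Fin n → Set) →
  (∀ {n} (d : Dir) {a g b : Fin n} → a ≺[ d ] g → g ≺[ d ] b → R g a → R b a) →
  Preserved λ {n} w k → Σ (Fin n) λ i → val w i ≡ k × (∀ j → j < i → R (lookup w j) (lookup w i))
prefix-preserved R cross d {v} {w} perm s (i , refl , r) with transfer s i
... | i′ , e = i′ , relabel {w = v} {w} e refl , λ j j<i′ →
  [ (λ t → subst (R (lookup w j)) (sym e) (before-related perm R r (subst (λ x → lookup w j ∷ x ∷ [] ⊆ v) e t)))
  , (λ { (ej , ei′) → subst₂ R (sym ej) (sym ei′) (cross d a≺g g≺b
      (subst (R g) (trans (sym e) ei′) (before-related perm R r
        (subst (λ x → g ∷ x ∷ [] ⊆ v) (trans (sym ei′) e) (⊆-trans (keep (skip (keep (skip (skip []))))) pattern-⊆))))) })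
  ]′ (back (lookup-⊆₂ w j<i′))
  where open Exchanged s

Lrmax-preserved : Preserved Lrmax
Lrmax-preserved = prefix-preserved _<_ λ
  { up a<g _ g<a → contradiction a<g (<-asym g<a) ; down g<a b<g _ → <-trans b<g g<a }

Lrmin-preserved : Preserved Lrmin
Lrmin-preserved = prefix-preserved (λ x y → y < x) λ
  { up a<g g<b _ → <-trans a<g g<b ; down g<a _ a<g → contradiction g<a (<-asym a<g) }

-- If `b` is a right-to-left maximum, it exceeds the later `l` and hence `g`. Upward this gives
-- `a < g < b`, as the new pair requires; downward it is impossible.
Rlmax-preserved : Preserved Rlmax
Rlmax-preserved {n} d {v} {w} perm s (i , refl , r) with transfer s i
... | i′ , e = i′ , relabel {w = v} {w} e refl , λ j i′<j →
  [ (λ t → subst (lookup w j <_) (sym e) (after-related perm _<_ r (subst (λ x → x ∷ lookup w j ∷ [] ⊆ v) e t)))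
  , (λ { (ei′ , ej) → subst₂ _<_ (sym ej) (sym ei′) (cross d a≺g g≺b (<-trans g<l
      (subst (l <_) (trans (sym e) ei′) (after-related perm _<_ r
        (subst (λ x → x ∷ l ∷ [] ⊆ v) (trans (sym ei′) e) (⊆-trans (skip (skip (skip (keep (keep []))))) pattern-⊆)))))) })
  ]′ (back (lookup-⊆₂ w i′<j))
  where
  open Exchanged s
  cross : (d : Dir) {a g b : Fin n} → a ≺[ d ] g → g ≺[ d ] b → g < b → a < b
  cross up   a<g g<b _   = <-trans a<g g<b
  cross down _   b<g g<b = contradiction b<g (<-asym g<b)

-- The exchanged letters are never consecutive values, since `g` lies strictly between them.
Ides-preserved : Preserved Ides
Ides-preserved d {v} {w} perm s (1≤k , k≤ , i , j , ei , ej , j<i) =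
  [ (λ t → kept (⊆⇒indices t))
  , (λ { (j≡a , i≡b) → ⊥-elim (gap d a≺g g≺b (trans (cong (suc ∘ toℕ) (sym j≡a))
      (trans ej (cong suc (trans (sym ei) (cong (suc ∘ toℕ) i≡b)))))) })
  ]′ (forth (lookup-⊆₂ v j<i))
  where
  open Exchanged s
  kept : (∃₂ λ j′ i′ → j′ < i′ × lookup w j′ ≡ lookup v j × lookup w i′ ≡ lookup v i) → Ides w _
  kept (j′ , i′ , j′<i′ , ej′ , ei′) = 1≤k , k≤ , i′ , j′ , relabel {w = v} {w} ei′ ei , relabel {w = v} {w} ej′ ej , j′<i′
  gap : ∀ {n} (d : Dir) {a g b : Fin n} → a ≺[ d ] g → g ≺[ d ] b → ¬ suc (toℕ a) ≡ suc (suc (toℕ b))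
  gap up   a<g g<b e = <⇒≢ (m<n⇒m<1+n (<-trans a<g g<b)) (suc-injective e)
  gap down g<a b<g e = <⇒≱ g<a (subst (_≤ toℕ _) (sym (suc-injective e)) b<g)

UpTo : Word n → Fin n → Fin n → Set
UpTo w x y = x ≡ y ⊎ x ∷ y ∷ [] ⊆ w

-- The initial run in terms of the relative order of letters, which `back` can transport, instead of
-- adjacent positions.
IncreasingUpTo : Word n → Fin n → Set
IncreasingUpTo w x = ∀ {y z} → y ∷ z ∷ [] ⊆ w → UpTo w z x → y < z

before-trans : {w : Word n} → IsPerm w → {x y z : Fin n} →
  x ∷ y ∷ [] ⊆ w → y ∷ z ∷ [] ⊆ w → x ∷ z ∷ [] ⊆ w
before-trans {w = w} perm t t′ with ⊆⇒indices t | ⊆⇒indices t′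
... | i , j , i<j , refl , refl | j′ , k , j′<k , e , refl =
  lookup-⊆₂ w (<-trans i<j (subst (_< k) (perm _ _ e) j′<k))

UpTo⇒≤ : {w : Word n} → IsPerm w → {j i : Fin n} → UpTo w (lookup w j) (lookup w i) → toℕ j ≤ toℕ i
UpTo⇒≤ perm (inj₁ e) = ≤-reflexive (cong toℕ (perm _ _ e))
UpTo⇒≤ perm (inj₂ t) with ⊆⇒indices t
... | j , i , j<i , ej , ei = <⇒≤ (subst₂ _<_ (perm _ _ ej) (perm _ _ ei) j<i)

run⇒increasing : (w : Word n) {i : Fin n} →
  (∀ j k → toℕ k ≡ suc (toℕ j) → toℕ k ≤ toℕ i → lookup w j < lookup w k) →
  ∀ j k → j < k → toℕ k ≤ toℕ i → lookup w j < lookup w k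
run⇒increasing {n} w {i} run j k = go (toℕ k) k refl
  where
  go : ∀ t (k : Fin n) → toℕ k ≡ t → j < k → toℕ k ≤ toℕ i → lookup w j < lookup w k
  go zero    k ek j<k k≤i with () ← subst (toℕ j <ℕ_) ek j<k
  go (suc t) k ek j<k k≤i = [ strictly , adjacent ]′ (m≤n⇒m<n∨m≡n (≤-pred (subst (toℕ j <ℕ_) ek j<k)))
    where
    t<n : t <ℕ n
    t<n = ≤-trans (≤-reflexive (sym ek)) (<⇒≤ (toℕ<n k))
    k⁻ : Fin n
    k⁻ = fromℕ< t<n
    ek⁻ : toℕ k⁻ ≡ t
    ek⁻ = toℕ-fromℕ< t<n
    adjacent : toℕ j ≡ t → lookup w j < lookup w k
    adjacent e = run j k (trans ek (cong suc (sym e))) k≤i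
    strictly : toℕ j <ℕ t → lookup w j < lookup w k
    strictly j<t = <-trans
      (go t k⁻ ek⁻ (subst (toℕ j <ℕ_) (sym ek⁻) j<t)
        (≤-trans (subst (_≤ toℕ k) (sym ek⁻) (≤-trans (n≤1+n t) (≤-reflexive (sym ek)))) k≤i))
      (run k⁻ k (trans ek (cong suc (sym ek⁻))) k≤i)

Iar⇒increasing : {w : Word n} → IsPerm w → {i : Fin n} →
  (∀ j k → toℕ k ≡ suc (toℕ j) → toℕ k ≤ toℕ i → lookup w j < lookup w k) → IncreasingUpTo w (lookup w i)
Iar⇒increasing {w = w} perm run t u with ⊆⇒indices t
... | j , k , j<k , refl , refl = run⇒increasing w run j k j<k (UpTo⇒≤ perm u)

increasing⇒Iar : (w : Word n) {i : Fin n} → IncreasingUpTo w (lookup w i) →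
  ∀ j k → toℕ k ≡ suc (toℕ j) → toℕ k ≤ toℕ i → lookup w j < lookup w k
increasing⇒Iar w inc j k e k≤i = inc (lookup-⊆₂ w (≤-reflexive (sym e)))
  ([ (λ k<i → inj₂ (lookup-⊆₂ w k<i)) , (λ k≡i → inj₁ (cong (lookup w) (toℕ-injective k≡i))) ]′ (m≤n⇒m<n∨m≡n k≤i))

-- The descent from g to the small letter lies before both exchanged letters, so neither is in the initial run.
increasing-preserved : (d : Dir) {v w : Word n} → IsPerm v → Rewrites d v w → {x : Fin n} →
  IncreasingUpTo v x → IncreasingUpTo w x
increasing-preserved {n} d {v} {w} perm s {x} inc t u =
  [ (λ t₀ → inc t₀ (upTo u))
  , (λ { (_ , refl) → ⊥-elim (a-outside (upTo u)) })
  ]′ (back t)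
  where
  open Exchanged s
  small-before : UpTo v a x → small ∷ x ∷ [] ⊆ v
  small-before (inj₁ refl) = ⊆-trans (skip (keep (keep (skip (skip []))))) pattern-⊆
  small-before (inj₂ t)    = before-trans perm (⊆-trans (skip (keep (keep (skip (skip []))))) pattern-⊆) t
  a-outside : ¬ UpTo v a x
  a-outside u = <-asym small<g (inc (⊆-trans (keep (keep (skip (skip (skip []))))) pattern-⊆) (inj₂ (small-before u)))
  upTo : ∀ {z} → UpTo w z x → UpTo v z x
  upTo (inj₁ e) = inj₁ e
  upTo (inj₂ t) = [ inj₂ , (λ { (_ , x≡a) → ⊥-elim (a-outside (inj₁ (sym x≡a))) }) ]′ (back t)

Iar-preserved : Preserved Iar
Iar-preserved d {v} {w} perm s (i , refl , run) with transfer s i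
... | i′ , e = i′ , relabel {w = v} {w} e refl , increasing⇒Iar w
  (subst (IncreasingUpTo w) (sym e) (increasing-preserved d perm s (Iar⇒increasing perm run)))

-- Rewriting sequences and the bijection.

rewriting-SameStats : (d : Dir) {v w : Word n} → IsPerm v → Star (Rewrites d) v w → SameStats w v
rewriting-SameStats d perm r =
  Preserved⇒SameSet Ides Ides-preserved d perm r ,
  Preserved⇒SameSet Lrmax Lrmax-preserved d perm r ,
  Preserved⇒SameSet Lrmin Lrmin-preserved d perm r ,
  Preserved⇒SameSet Rlmax Rlmax-preserved d perm r ,
  Preserved⇒SameSet Iar Iar-preserved d perm r

rewriting-IsPerm : (d : Dir) {v w : Word n} → Star (Rewrites d) v w → IsPerm v → IsPerm w
rewriting-IsPerm d ε        perm = perm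
rewriting-IsPerm d (s ◅ ss) perm = rewriting-IsPerm d ss (IsPerm-step s perm)

rewriting-opposite : (d : Dir) {v w : Vec (Fin n) m} → Star (Rewrites d) v w → Star (Rewrites (opposite d)) w v
rewriting-opposite d = reverse (Step-opposite d)

theorem1p2 : ∀ (n : ℕ) → 1 ≤ n →
    Σ (Word n → Word n) λ α →
    (∀ π → InClassA π → InClassB (α π)) ×
    (∀ π σ → InClassA π → InClassA σ → α π ≡ α σ → π ≡ σ) ×
    (∀ τ → InClassB τ → Σ (Word n) λ π → InClassA π × (α π ≡ τ)) ×
    (∀ π → InClassA π → SameStats (α π) π)
theorem1p2 n _ = α , α-InClassB , α-injective , α-surjective ,
  λ π A → rewriting-SameStats down (proj₁ A) (rewrites π)
  where
  α : Word n → Word n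
  α π = proj₁ (normalize down π)
  α-normal : ∀ π → IsNormalForm (Rewrites down) (α π)
  α-normal π = proj₁ (proj₂ (normalize down π))
  rewrites : ∀ π → Star (Rewrites down) π (α π)
  rewrites π = proj₂ (proj₂ (normalize down π))
  α-InClassB : ∀ π → InClassA π → InClassB (α π)
  α-InClassB π A = normal⇒InClassB (rewriting-IsPerm down (rewrites π) (proj₁ A)) (α-normal π)
  α-injective : ∀ π σ → InClassA π → InClassA σ → α π ≡ α σ → π ≡ σ
  -- Reversed, the two rewritings lead by `up` steps from the common word `α π` to `π` and `σ`, both
  -- normal for `up`.
  α-injective π σ A A′ e = normal-unique up (InClassA⇒normal A) (InClassA⇒normal A′)
    (rewriting-opposite down (rewrites π))
    (rewriting-opposite down (subst (Star (Rewrites down) σ) (sym e) (rewrites σ)))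
  α-surjective : ∀ τ → InClassB τ → Σ (Word n) λ π → InClassA π × (α π ≡ τ)
  -- The preimage is the `up` normal form of `τ`. Reversing its rewriting leads down to `τ`, which
  -- is normal for `down` and so equals `α π`.
  α-surjective τ B with normalize up τ
  ... | π , normal , r = π , normal⇒InClassA (rewriting-IsPerm up r (proj₁ B)) normal ,
    normal-unique down (α-normal π) (InClassB⇒normal B) (rewrites π) (rewriting-opposite up r)
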